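{- Let $P\in\mathbb{Q}_{\ge0}^{N\times N}$ be the transition matrix of a reversible and ergodic Markov chain on $V$ with stationary distribution $\pi$ and mixing rate $t^*$. For the rotor-router model on a multidigraph for $P$, with any initial configuration, $$\left|\chi^{(T)}_w-\mu^{(T)}_w\right|\le\frac{3\pi_w}{\pi_{\min}}\,t^*\,\Delta\,\bar\Delta$$ for all $w\in V$ and $T\ge0$.
   Context: Let $V=\{1,\dots,N\}$ and let $P\in\mathbb{Q}_{\ge 0}^{N\times N}$ be an ergodic (irreducible, aperiodic) stochastic matrix with stationary distribution $\pi$; $\pi_{\min}=\min_v\pi_v$; reversible means $\pi_uP_{u,v}=\pi_vP_{v,u}$ for all $u,v$. For $v\in V$ let $\mathcal N(v)=\{u: P_{v,u}>0\}$, $\delta(v)=|\mathcal N(v)|$, $\Delta=\max_v\delta(v)$. Total variation distance $d_{TV}(\xi,\zeta)=\frac12\|\xi-\zeta\|_1$; mixing time $\tau(\varepsilon)=\max_{v}\min\{t\ge0: d_{TV}(P^t_{v,\cdot},\pi)\le\varepsilon\}$; mixing rate $t^*=\tau(1/4)$. For each $v$ let $\bar\delta(v)$ be a positive integer with $\bar\delta(v)P_{v,u}\in\mathbb{Z}$ for all $u$, and $\bar\Delta=\max_v\bar\delta(v)$. The rotor router: $\sigma_v(0),\dots,\sigma_v(\bar\delta(v)-1)\in\mathcal N(v)$ is any sequence in which each $u\in\mathcal N(v)$ occurs exactly $\bar\delta(v)P_{v,u}$ times, extended by $\sigma_v(i)=\sigma_v(i\bmod\bar\delta(v))$. Write $I_{v,u}[z,z')=|\{j\in\{z,\dots,z'-1\}:\sigma_v(j)=u\}|$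 (zero if $z'\le z$). Given $\chi^{(0)}\in\mathbb{Z}_{\ge0}^N$, set $Z^{(t)}_{v,u}=I_{v,u}\big[\sum_{s=0}^{t-1}\chi^{(s)}_v,\sum_{s=0}^{t}\chi^{(s)}_v\big)$, $\chi^{(t+1)}_u=\sum_vZ^{(t)}_{v,u}$, $\mu^{(0)}=\chi^{(0)}$, $\mu^{(t)}=\mu^{(0)}P^t$. -}

module Defs where

open import Algebra.Bundles using (CommutativeRing)
open import Data.Fin.Base using (Fin; zero; suc)
open import Data.Fin.Properties using (_≟_)
open import Data.Integer.Base using (+_)
open import Data.List.Base using (length; filter; allFin; tabulate; applyUpTo)
open import Data.List.Extrema.Nat using (max)
open import Data.List.Relation.Unary.All.Properties using (tabulate⁺)
open import Data.Nat.Base as ℕ using (ℕ; zero; suc)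
open import Data.Nat.Divisibility using (_∣_)
open import Data.Nat.DivMod using (_mod_)
import Data.Nat.Properties as ℕ
open import Data.Product.Base using (Σ-syntax; ∃-syntax; _×_; _,_)
open import Data.Rational.Base
open import Data.Rational.Properties hiding (_≟_)
open import Relation.Binary.Bundles using (DecTotalOrder)
open import Relation.Binary.PropositionalEquality
  using (_≡_; refl; sym; trans; cong; subst)
open import Relation.Nullary using (yes; no; contradiction)

open import Algebra.Properties.Semiring.Sum
  (CommutativeRing.semiring +-*-commutativeRing) public
  using () renaming (sum to sumℚ)
open import Algebra.Properties.Semiring.Sum ℕ.+-*-semiring public
  using () renaming (sum to sumℕ)
open import Data.List.Extrema (DecTotalOrder.totalOrder ≤-decTotalOrder)
  using (argmin-all) renaming (min to minℚ)

fromℕ : ℕ → ℚ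
fromℕ k = + k / 1

RowVec : ℕ → Set
RowVec N = Fin N → ℚ

Matrix : ℕ → Set
Matrix N = Fin N → Fin N → ℚ

idMatrix : ∀ {N} → Matrix N
idMatrix u v with u ≟ v
... | yes _ = 1ℚ
... | no  _ = 0ℚ

infixl 7 _∙ᵐ_ _∙ᵛ_
infixr 8 _^ᵐ_

_∙ᵐ_ : ∀ {N} → Matrix N → Matrix N → Matrix N
(A ∙ᵐ B) u w = sumℚ (λ v → A u v * B v w)

_∙ᵛ_ : ∀ {N} → RowVec N → Matrix N → RowVec N
(x ∙ᵛ A) u = sumℚ (λ v → x v * A v u)

_^ᵐ_ : ∀ {N} → Matrix N → ℕ → Matrix N
P ^ᵐ zero  = idMatrix
P ^ᵐ suc t = P ∙ᵐ (P ^ᵐ t)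

------------------------------------------------------------------------
-- Markov chains

record IsStochastic {N} (P : Matrix N) : Set where
  field
    entry≥0 : ∀ u v → 0ℚ ≤ P u v
    rowSum  : ∀ u → sumℚ (P u) ≡ 1ℚ

Irreducible : ∀ {N} → Matrix N → Set
Irreducible P = ∀ u v → ∃[ t ] (P ^ᵐ t) u v > 0ℚ

-- The greatest common divisor of the (infinite) set of return times is 1.
Aperiodic : ∀ {N} → Matrix N → Set
Aperiodic P =
  ∀ v d → (∀ t → t ℕ.> 0 → (P ^ᵐ t) v v > 0ℚ → d ∣ t) → d ≡ 1

record IsErgodic {N} (P : Matrix N) : Set where
  field
    irreducible : Irreducible P
    aperiodic   : Aperiodic P

-- Rational entries lose nothing: the stationary distribution of an
-- irreducible chain is the unique solution of a linear system over ℚ.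
record IsStationary {N} (P : Matrix N) (π : RowVec N) : Set where
  field
    entry≥0  : ∀ v → 0ℚ ≤ π v
    total    : sumℚ π ≡ 1ℚ
    balanced : ∀ v → (π ∙ᵛ P) v ≡ π v

Reversible : ∀ {N} → Matrix N → RowVec N → Set
Reversible P π = ∀ u v → π u * P u v ≡ π v * P v u

minEntry : ∀ {n} → RowVec (suc n) → ℚ
minEntry π = minℚ (π zero) (tabulate π)

-- All families maximised here consist of naturals, so 0 is a harmless
-- starting value.
maxℕ : ∀ {N} → (Fin N → ℕ) → ℕ
maxℕ f = max 0 (tabulate f)

dTV : ∀ {N} → RowVec N → RowVec N → ℚ
dTV ξ ζ = ½ * sumℚ (λ v → ∣ ξ v - ζ v ∣)

IsLeast : (ℕ → Set) → ℕ → Set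
IsLeast A t = A t × (∀ s → A s → t ℕ.≤ s)

-- τ = max_v min { t | dTV (Pᵗ_{v,·}) π ≤ ε }.  It is a relation because the
-- minima exist only by the convergence theorem for ergodic chains.
IsMixingTime : ∀ {N} → Matrix N → RowVec N → ℚ → ℕ → Set
IsMixingTime {N} P π ε τ =
  Σ[ τᵥ ∈ (Fin N → ℕ) ]
    (∀ v → IsLeast (λ t → dTV ((P ^ᵐ t) v) π ≤ ε) (τᵥ v)) × τ ≡ maxℕ τᵥ

IsMixingRate : ∀ {N} → Matrix N → RowVec N → ℕ → Set
IsMixingRate P π = IsMixingTime P π (+ 1 / 4)

degree : ∀ {N} → Matrix N → Fin N → ℕ
degree {N} P v = length (filter (λ u → 0ℚ <? P v u) (allFin N))

maxDegree : ∀ {N} → Matrix N → ℕ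
maxDegree P = maxℕ (degree P)

------------------------------------------------------------------------
-- The rotor-router model

-- A multidigraph for P together with the rotor sequences, given on one
-- period.
record RotorRouter {N} (P : Matrix N) : Set where
  field
    δ̄         : Fin N → ℕ
    δ̄-nonZero : ∀ v → ℕ.NonZero (δ̄ v)
    integral  : ∀ v u → ∃[ z ] fromℕ (δ̄ v) * P v u ≡ z / 1
    rotor     : ∀ v → Fin (δ̄ v) → Fin N
    rotor∈𝒩   : ∀ v j → P v (rotor v j) > 0ℚ
    frequency : ∀ v u → P v u > 0ℚ →
      fromℕ (length (filter (λ j → rotor v j ≟ u) (allFin (δ̄ v))))
        ≡ fromℕ (δ̄ v) * P v u

  σ : Fin N → ℕ → Fin N
  σ v i = rotor v (_mod_ i (δ̄ v) ⦃ δ̄-nonZero v ⦄)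

  Δ̄ : ℕ
  Δ̄ = maxℕ δ̄

  -- The number of j with z ≤ j < z′ and σ v j ≡ u.
  I : Fin N → Fin N → ℕ → ℕ → ℕ
  I v u z z′ =
    length (filter (λ j → σ v j ≟ u) (applyUpTo (z ℕ.+_) (z′ ℕ.∸ z)))

  module _ (χ₀ : Fin N → ℕ) where

    mutual
      χ : ℕ → Fin N → ℕ
      χ zero    u = χ₀ u
      χ (suc t) u = sumℕ (λ v → Z t v u)

      -- emitted t v = χ 0 v + ⋯ + χ (t - 1) v
      emitted : ℕ → Fin N → ℕ
      emitted zero    v = 0
      emitted (suc t) v = emitted t v ℕ.+ χ t v

      -- The upper end is emitted (suc t) v, unfolded for termination checking.
      Z : ℕ → Fin N → Fin N → ℕ
      Z t v u = I v u (emitted t v) (emitted t v ℕ.+ χ t v)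

μ : ∀ {N} → Matrix N → (Fin N → ℕ) → ℕ → RowVec N
μ P χ₀ t = (λ v → fromℕ (χ₀ v)) ∙ᵛ (P ^ᵐ t)

------------------------------------------------------------------------
-- minEntry π is nonzero, so that one may divide by it

private
  sum-pos : ∀ {N} (f : RowVec N) → sumℚ f > 0ℚ → ∃[ x ] f x > 0ℚ
  sum-pos {zero}  f 0<0 = contradiction 0<0 (<-irrefl refl)
  sum-pos {suc N} f 0<s with 0ℚ <? f zero
  ... | yes 0<f = zero , 0<f
  ... | no  0≮f with sum-pos (λ i → f (suc i))
                       (<-≤-trans 0<s
                         (≤-trans (+-monoˡ-≤ _ (≮⇒≥ 0≮f))
                                  (≤-reflexive (+-identityˡ _))))
  ...   | x , 0<fx = suc x , 0<fx

  sum-nonNeg : ∀ {N} (f : RowVec N) → (∀ x → 0ℚ ≤ f x) → 0ℚ ≤ sumℚ f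
  sum-nonNeg {zero}  f 0≤f = ≤-refl
  sum-nonNeg {suc N} f 0≤f =
    +-mono-≤ (0≤f zero) (sum-nonNeg (λ i → f (suc i)) (λ i → 0≤f (suc i)))

  term≤sum : ∀ {N} (f : RowVec N) → (∀ x → 0ℚ ≤ f x) → ∀ x → f x ≤ sumℚ f
  term≤sum {suc N} f 0≤f zero = ≤-trans (≤-reflexive (sym (+-identityʳ _)))
    (+-monoʳ-≤ (f zero) (sum-nonNeg (λ i → f (suc i)) (λ i → 0≤f (suc i))))
  term≤sum {suc N} f 0≤f (suc x) =
    ≤-trans (term≤sum (λ i → f (suc i)) (λ i → 0≤f (suc i)) x)
      (≤-trans (≤-reflexive (sym (+-identityˡ _))) (+-monoˡ-≤ _ (0≤f zero)))

  *-pos : ∀ {p q} → p > 0ℚ → q > 0ℚ → p * q > 0ℚ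
  *-pos {p} {q} 0<p 0<q =
    positive⁻¹ (p * q) ⦃ pos*pos⇒pos p ⦃ positive 0<p ⦄ q ⦃ positive 0<q ⦄ ⦄

  *-nonNeg : ∀ {p q} → 0ℚ ≤ p → 0ℚ ≤ q → 0ℚ ≤ p * q
  *-nonNeg {p} {q} 0≤p 0≤q = nonNegative⁻¹ (p * q)
    ⦃ nonNeg*nonNeg⇒nonNeg p ⦃ nonNegative 0≤p ⦄ q ⦃ nonNegative 0≤q ⦄ ⦄

  factors-pos : ∀ {p q} → 0ℚ ≤ p → p * q > 0ℚ → p > 0ℚ × q > 0ℚ
  factors-pos {p} {q} 0≤p 0<pq = 0<p , 0<q
    where
    0<p : p > 0ℚ
    0<p with 0ℚ <? p
    ... | yes lt = lt
    ... | no  ge = contradiction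
      (trans (cong (_* q) (≤-antisym (≮⇒≥ ge) 0≤p)) (*-zeroˡ q))
      (λ eq → <-irrefl (sym eq) 0<pq)
    0<q : q > 0ℚ
    0<q with 0ℚ <? q
    ... | yes lt = lt
    ... | no  ge = contradiction
      (<-≤-trans 0<pq (≤-trans
        (*-monoˡ-≤-nonNeg p ⦃ nonNegative 0≤p ⦄ (≮⇒≥ ge))
        (≤-reflexive (*-zeroʳ p))))
      (<-irrefl refl)

module _ {N} {P : Matrix N} {π : RowVec N} (stoch : IsStochastic P)
         (irr : Irreducible P) (stat : IsStationary P π) where

  private
    module P = IsStochastic stoch
    module π = IsStationary stat

    step : ∀ {u x} → π u > 0ℚ → P u x > 0ℚ → π x > 0ℚ
    step {u} {x} 0<πu 0<Pux = <-≤-trans (*-pos 0<πu 0<Pux)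
      (≤-trans
        (term≤sum (λ v → π v * P v x) (λ v → *-nonNeg (π.entry≥0 v) (P.entry≥0 v x)) u)
        (≤-reflexive (π.balanced x)))

    reach : ∀ t {u v} → π u > 0ℚ → (P ^ᵐ t) u v > 0ℚ → π v > 0ℚ
    reach zero {u} {v} 0<πu 0<Iuv with u ≟ v
    ... | yes refl = 0<πu
    ... | no  _    = contradiction 0<Iuv (<-irrefl refl)
    reach (suc t) {u} {v} 0<πu 0<s
      with x , 0<x ← sum-pos (λ x → P u x * (P ^ᵐ t) x v) 0<s
      with 0<Pux , 0<Ptxv ← factors-pos {P u x} (P.entry≥0 u x) 0<x
      = reach t (step 0<πu 0<Pux) 0<Ptxv

  stationary-pos : ∀ v → π v > 0ℚ
  stationary-pos v
    with u , 0<πu ← sum-pos π (subst (_> 0ℚ) (sym π.total) (positive⁻¹ 1ℚ))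
    with t , 0<Puv ← irr u v
    = reach t 0<πu 0<Puv

minEntry-nonZero : ∀ {n} {P : Matrix (suc n)} {π : RowVec (suc n)} →
  IsStochastic P → IsErgodic P → IsStationary P π → NonZero (minEntry π)
minEntry-nonZero stoch erg stat = >-nonZero
  (argmin-all (λ p → p) {P = 0ℚ <_} (π>0 zero) (tabulate⁺ π>0))
  where
  π>0 = stationary-pos stoch (IsErgodic.irreducible erg) stat

{-# OPTIONS --safe #-}
-- Let e(s) = ‖P^s_{w,·} − π‖₁.  Right multiplication by P^t* − 1π halves the
-- ℓ¹-norm, so e(t* + s) is at most both ½ and ½ e(s), and e sums to at most 3 t*.
-- In every step the router sends along (v,u) an amount that differs from
-- χ_v P_{v,u} by at most δ̄(v) P_{v,u}, because full periods contribute exactly.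
-- These errors sum to 0 over u, so when they are propagated through P^s the
-- entry P^s_{u,w} may be replaced by P^s_{u,w} − π_w, which reversibility turns
-- into (π_w/π_u)(P^s_{w,u} − π_u).  Reversibility also bounds the column sums of
-- P by Δ.  Telescoping χ^(T) − χ^(0) P^T over the steps gives the bound.
module Submission where

open import Defs
open import Algebra.Bundles using (CommutativeRing)
open import Data.Fin.Base using (Fin; zero; suc; toℕ)
import Data.Fin.Properties as Fin
import Data.Integer.Base as ℤ
import Data.Integer.Properties as ℤ
open import Data.List.Base using (length; filter; tabulate; applyUpTo)
import Data.List.Extrema.Nat as Extremaℕ
open import Data.List.Relation.Unary.All.Properties using (tabulate⁻; tabulate⁺)
open import Data.Nat.Base as ℕ using (ℕ; zero; suc)
import Data.Nat.DivMod as ℕ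
import Data.Nat.Properties as ℕ
open import Data.Product.Base using (_,_; proj₁)
open import Data.Rational.Base
open import Data.Rational.Properties
open import Data.Rational.Solver using (module +-*-Solver)
import Data.Rational.Unnormalised.Base as ℚᵘ
import Data.Rational.Unnormalised.Properties as ℚᵘ
open import Data.Sum.Base using (inj₁; inj₂)
open import Function.Base using (_∘_; id)
open import Relation.Binary.Bundles using (DecTotalOrder)
open import Relation.Binary.PropositionalEquality
open import Relation.Nullary using (Dec; yes; no; contradiction)
open import Relation.Unary using (Decidable)
open import Data.List.Extrema (DecTotalOrder.totalOrder ≤-decTotalOrder)
  using (min≤xs; argmin-all)
open import Algebra.Properties.Semiring.Sum
  (CommutativeRing.semiring +-*-commutativeRing)
  using (sum-cong-≗; sum-replicate-zero; ∑-distrib-+; ∑-comm; *-distribˡ-sum; *-distribʳ-sum)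
open RotorRouter using (χ; Δ̄)
open +-*-Solver using (solve; _:=_; _:+_; _:*_; _:-_; :-_; con)

private
  variable
    N : ℕ

-- Order and arithmetic of the naturals inside ℚ.

fromℕ-+ : ∀ m n → fromℕ (m ℕ.+ n) ≡ fromℕ m + fromℕ n
-- `fromℕ` normalises its fraction and is stuck on variables, so the equation is checked among
-- unnormalised fractions with denominator 1.
fromℕ-+ m n = toℚᵘ-injective (begin
  toℚᵘ (fromℕ (m ℕ.+ n))                ≈⟨ toℚᵘ-fromℚᵘ _ ⟩
  ℚᵘ.mkℚᵘ (ℤ.+ (m ℕ.+ n)) 0              ≈⟨ ℚᵘ.*≡* (cong (ℤ._* ℤ.1ℤ) (cong₂ ℤ._+_ (sym (ℤ.*-identityʳ (ℤ.+ m))) (sym (ℤ.*-identityʳ (ℤ.+ n))))) ⟩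
  ℚᵘ.mkℚᵘ (ℤ.+ m) 0 ℚᵘ.+ ℚᵘ.mkℚᵘ (ℤ.+ n) 0 ≈⟨ ℚᵘ.+-cong (toℚᵘ-fromℚᵘ (ℚᵘ.mkℚᵘ (ℤ.+ m) 0)) (toℚᵘ-fromℚᵘ (ℚᵘ.mkℚᵘ (ℤ.+ n) 0)) ⟨
  toℚᵘ (fromℕ m) ℚᵘ.+ toℚᵘ (fromℕ n)     ≈⟨ toℚᵘ-homo-+ (fromℕ m) (fromℕ n) ⟨
  toℚᵘ (fromℕ m + fromℕ n)              ∎)
  where open ℚᵘ.≃-Reasoning

0≤fromℕ : ∀ n → 0ℚ ≤ fromℕ n
0≤fromℕ n = nonNegative⁻¹ _ ⦃ normalize-nonNeg n 1 ⦄

fromℕ-mono-≤ : ∀ {m n} → m ℕ.≤ n → fromℕ m ≤ fromℕ n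
fromℕ-mono-≤ {m} {n} m≤n = begin
  fromℕ m                       ≡⟨ +-identityʳ _ ⟨
  fromℕ m + 0ℚ                  ≤⟨ +-monoʳ-≤ (fromℕ m) (0≤fromℕ (n ℕ.∸ m)) ⟩
  fromℕ m + fromℕ (n ℕ.∸ m)     ≡⟨ fromℕ-+ m (n ℕ.∸ m) ⟨
  fromℕ (m ℕ.+ (n ℕ.∸ m))       ≡⟨ cong fromℕ (ℕ.m+[n∸m]≡n m≤n) ⟩
  fromℕ n                       ∎
  where open ≤-Reasoning

*-monoˡ : ∀ {r p q} → 0ℚ ≤ r → p ≤ q → r * p ≤ r * q
*-monoˡ {r} 0≤r = *-monoˡ-≤-nonNeg r ⦃ nonNegative 0≤r ⦄

*-monoʳ : ∀ {r p q} → 0ℚ ≤ r → p ≤ q → p * r ≤ q * r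
*-monoʳ {r} 0≤r = *-monoʳ-≤-nonNeg r ⦃ nonNegative 0≤r ⦄

0≤p*q : ∀ {p q} → 0ℚ ≤ p → 0ℚ ≤ q → 0ℚ ≤ p * q
0≤p*q {p} {q} 0≤p 0≤q = subst (_≤ p * q) (*-zeroʳ p) (*-monoˡ 0≤p 0≤q)

-- Two points of the interval from 0 to `r` are at most its length apart; the triangle inequality
-- would give only 2r.
∣p-q∣≤r : ∀ {p q r} → 0ℚ ≤ p → p ≤ r → 0ℚ ≤ q → q ≤ r → ∣ p - q ∣ ≤ r
∣p-q∣≤r {p} {q} {r} 0≤p p≤r 0≤q q≤r with ∣p∣≡p∨∣p∣≡-p (p - q)
... | inj₁ eq = begin
  ∣ p - q ∣  ≡⟨ eq ⟩
  p - q      ≤⟨ +-mono-≤ p≤r (neg-antimono-≤ 0≤q) ⟩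
  r + 0ℚ     ≡⟨ +-identityʳ r ⟩
  r          ∎
  where open ≤-Reasoning
... | inj₂ eq = begin
  ∣ p - q ∣  ≡⟨ eq ⟩
  - (p - q)  ≡⟨ solve 2 (λ p q → :- (p :- q) := q :- p) refl p q ⟩
  q - p      ≤⟨ +-mono-≤ q≤r (neg-antimono-≤ 0≤p) ⟩
  r + 0ℚ     ≡⟨ +-identityʳ r ⟩
  r          ∎
  where open ≤-Reasoning

-- All estimates below carry `minEntry π` as a factor on the left; this removes it once, at the very
-- end.
p≤1/m*q : ∀ {m p q} .⦃ _ : NonZero m ⦄ → 0ℚ < m → m * p ≤ q → p ≤ 1/ m * q
p≤1/m*q {m} {p} {q} 0<m mp≤q = *-cancelˡ-≤-pos m ⦃ positive 0<m ⦄ (begin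
  m * p              ≤⟨ mp≤q ⟩
  q                  ≡⟨ *-identityˡ q ⟨
  1ℚ * q             ≡⟨ cong (_* q) (*-inverseʳ m) ⟨
  m * 1/ m * q       ≡⟨ *-assoc m (1/ m) q ⟩
  m * (1/ m * q)     ∎)
  where open ≤-Reasoning

-- Finite sums

sum-mono : {f g : RowVec N} → (∀ i → f i ≤ g i) → sumℚ f ≤ sumℚ g
sum-mono {zero}  f≤g = ≤-refl
sum-mono {suc N} f≤g = +-mono-≤ (f≤g zero) (sum-mono (f≤g ∘ suc))

sum-zero : {f : RowVec N} → (∀ i → f i ≡ 0ℚ) → sumℚ f ≡ 0ℚ
sum-zero {N} f≡0 = trans (sum-cong-≗ f≡0) (sum-replicate-zero N)

0≤sum : {f : RowVec N} → (∀ i → 0ℚ ≤ f i) → 0ℚ ≤ sumℚ f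
0≤sum {N} {f} 0≤f = subst (_≤ sumℚ f) (sum-replicate-zero N) (sum-mono 0≤f)

term≤sum : {f : RowVec N} → (∀ i → 0ℚ ≤ f i) → ∀ i → f i ≤ sumℚ f
term≤sum {f = f} 0≤f zero = subst (_≤ sumℚ f) (+-identityʳ _)
  (+-monoʳ-≤ (f zero) (0≤sum (0≤f ∘ suc)))
term≤sum {f = f} 0≤f (suc i) = subst (_≤ sumℚ f) (+-identityˡ _)
  (+-mono-≤ (0≤f zero) (term≤sum (0≤f ∘ suc) i))

sum-single : {f : RowVec N} (j : Fin N) → (∀ i → i ≢ j → f i ≡ 0ℚ) → sumℚ f ≡ f j
sum-single {f = f} zero f≡0 = trans
  (cong (f zero +_) (sum-zero (λ i → f≡0 (suc i) λ ()))) (+-identityʳ _)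
sum-single {f = f} (suc j) f≡0 = trans
  (cong₂ _+_ (f≡0 zero λ ())
    (sum-single j (λ i i≢j → f≡0 (suc i) (i≢j ∘ Fin.suc-injective))))
  (+-identityˡ _)

sum-neg : (f : RowVec N) → sumℚ (λ i → - f i) ≡ - sumℚ f
sum-neg {zero}  f = refl
sum-neg {suc N} f = trans (cong (- f zero +_) (sum-neg (f ∘ suc)))
  (sym (neg-distrib-+ (f zero) (sumℚ (f ∘ suc))))

sum-sub : (f g : RowVec N) → sumℚ (λ i → f i - g i) ≡ sumℚ f - sumℚ g
sum-sub f g = trans (∑-distrib-+ f (λ i → - g i)) (cong (sumℚ f +_) (sum-neg g))

∣sum∣≤sum∣∣ : (f : RowVec N) → ∣ sumℚ f ∣ ≤ sumℚ (λ i → ∣ f i ∣)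
∣sum∣≤sum∣∣ {zero}  f = ≤-refl
∣sum∣≤sum∣∣ {suc N} f = ≤-trans (∣p+q∣≤∣p∣+∣q∣ (f zero) _)
  (+-monoʳ-≤ ∣ f zero ∣ (∣sum∣≤sum∣∣ (f ∘ suc)))

fromℕ-sum : (f : Fin N → ℕ) → fromℕ (sumℕ f) ≡ sumℚ (fromℕ ∘ f)
fromℕ-sum {zero}  f = refl
fromℕ-sum {suc N} f = trans (fromℕ-+ (f zero) _)
  (cong (fromℕ (f zero) +_) (fromℕ-sum (f ∘ suc)))

-- Written as a sum over `Fin n`, so that exchange of sums and distributivity apply to time and
-- index sums as well.
∑< : ℕ → (ℕ → ℚ) → ℚ
∑< n f = sumℚ {n} (f ∘ toℕ)

∑<-+ : ∀ m n f → ∑< (m ℕ.+ n) f ≡ ∑< m f + ∑< n (f ∘ (m ℕ.+_))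
∑<-+ zero    n f = sym (+-identityˡ _)
∑<-+ (suc m) n f = trans (cong (f 0 +_) (∑<-+ m n (f ∘ suc)))
  (sym (+-assoc (f 0) _ _))

∑<-const : ∀ n c → ∑< n (λ _ → c) ≡ fromℕ n * c
∑<-const zero    c = sym (*-zeroˡ c)
∑<-const (suc n) c = begin
  c + ∑< n (λ _ → c)       ≡⟨ cong (c +_) (∑<-const n c) ⟩
  c + fromℕ n * c          ≡⟨ solve 2 (λ c n → c :+ n :* c := (con 1ℚ :+ n) :* c) refl c (fromℕ n) ⟩
  (1ℚ + fromℕ n) * c       ≡⟨ cong (_* c) (fromℕ-+ 1 n) ⟨
  fromℕ (suc n) * c        ∎
  where open ≡-Reasoning

-- Counting

𝟙 : ∀ {a} {A : Set a} → Dec A → ℚ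
𝟙 (yes _) = 1ℚ
𝟙 (no _)  = 0ℚ

0≤𝟙 : ∀ {a} {A : Set a} (A? : Dec A) → 0ℚ ≤ 𝟙 A?
0≤𝟙 (yes _) = nonNegative⁻¹ 1ℚ
0≤𝟙 (no _)  = ≤-refl

module _ {a p} {A : Set a} {Q : A → Set p} (Q? : Decidable Q) where

  count-tabulate : ∀ {n} (f : Fin n → A) →
    fromℕ (length (filter Q? (tabulate f))) ≡ sumℚ (𝟙 ∘ Q? ∘ f)
  count-tabulate {zero}  f = refl
  count-tabulate {suc n} f with Q? (f zero)
  ... | yes _ = trans (fromℕ-+ 1 (length (filter Q? (tabulate (f ∘ suc))))) (cong (1ℚ +_) (count-tabulate (f ∘ suc)))
  ... | no  _ = trans (count-tabulate (f ∘ suc)) (sym (+-identityˡ _))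

  count-applyUpTo : ∀ (f : ℕ → A) n →
    fromℕ (length (filter Q? (applyUpTo f n))) ≡ ∑< n (𝟙 ∘ Q? ∘ f)
  count-applyUpTo f zero    = refl
  count-applyUpTo f (suc n) with Q? (f 0)
  ... | yes _ = trans (fromℕ-+ 1 (length (filter Q? (applyUpTo (f ∘ suc) n)))) (cong (1ℚ +_) (count-applyUpTo (f ∘ suc) n))
  ... | no  _ = trans (count-applyUpTo (f ∘ suc) n) (sym (+-identityˡ _))

sum-𝟙≡1 : (j : Fin N) → sumℚ (λ i → 𝟙 (j Fin.≟ i)) ≡ 1ℚ
sum-𝟙≡1 j = trans (sum-single j off) on
  where
  off : ∀ i → i ≢ j → 𝟙 (j Fin.≟ i) ≡ 0ℚ
  off i i≢j with j Fin.≟ i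
  ... | yes j≡i = contradiction (sym j≡i) i≢j
  ... | no  _   = refl
  on : 𝟙 (j Fin.≟ j) ≡ 1ℚ
  on with j Fin.≟ j
  ... | yes _   = refl
  ... | no  j≢j = contradiction refl j≢j

≤maxℕ : (f : Fin N → ℕ) → ∀ i → f i ℕ.≤ maxℕ f
≤maxℕ f = tabulate⁻ (Extremaℕ.xs≤max 0 (tabulate f))

minEntry≤ : ∀ {n} (π : RowVec (suc n)) v → minEntry π ≤ π v
minEntry≤ π = tabulate⁻ (min≤xs (π zero) (tabulate π))

-- Sums of periodic sequences.

module Periodic (m : ℕ) ⦃ _ : ℕ.NonZero m ⦄ where

  -- The first k + m terms split either as k then m or as m then k. By periodicity the second
  -- splitting ends in `∑< k f`, which cancels against the start of the first.
  shift-invariant : ∀ f → (∀ i → f (m ℕ.+ i) ≡ f i) → ∀ k →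
    ∑< m (f ∘ (k ℕ.+_)) ≡ ∑< m f
  shift-invariant f per k = begin
    ∑< m (f ∘ (k ℕ.+_))                     ≡⟨ solve 2 (λ a b → b := (a :+ b) :- a) refl (∑< k f) _ ⟩
    (∑< k f + ∑< m (f ∘ (k ℕ.+_))) - ∑< k f ≡⟨ cong (_- ∑< k f) (∑<-+ k m f) ⟨
    ∑< (k ℕ.+ m) f - ∑< k f                 ≡⟨ cong (λ l → ∑< l f - ∑< k f) (ℕ.+-comm k m) ⟩
    ∑< (m ℕ.+ k) f - ∑< k f                 ≡⟨ cong (_- ∑< k f) (∑<-+ m k f) ⟩
    (∑< m f + ∑< k (f ∘ (m ℕ.+_))) - ∑< k f ≡⟨ cong (λ x → (∑< m f + x) - ∑< k f) (sum-cong-≗ {k} (per ∘ toℕ)) ⟩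
    (∑< m f + ∑< k f) - ∑< k f              ≡⟨ solve 2 (λ a b → (a :+ b) :- b := a) refl (∑< m f) (∑< k f) ⟩
    ∑< m f                                  ∎
    where open ≡-Reasoning

  module _ (f : ℕ → ℚ) (p : ℚ) (0≤f : ∀ i → 0ℚ ≤ f i) (0≤p : 0ℚ ≤ p)
           (per : ∀ i → f (m ℕ.+ i) ≡ f i) (total : ∑< m f ≡ fromℕ m * p) where

    private
      D : ℕ → ℚ
      D n = ∑< n f - fromℕ n * p

      D-period : ∀ n → D (m ℕ.+ n) ≡ D n
      D-period n = begin
        ∑< (m ℕ.+ n) f - fromℕ (m ℕ.+ n) * p
          ≡⟨ cong₂ (λ x y → x - y * p)
               (trans (∑<-+ m n f) (cong₂ _+_ total (sum-cong-≗ {n} (per ∘ toℕ))))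
               (fromℕ-+ m n) ⟩
        (fromℕ m * p + ∑< n f) - (fromℕ m + fromℕ n) * p
          ≡⟨ solve 4 (λ m p s n → (m :* p :+ s) :- (m :+ n) :* p := s :- n :* p)
               refl (fromℕ m) p (∑< n f) (fromℕ n) ⟩
        D n ∎
        where open ≡-Reasoning

      D-periods : ∀ q n → D (q ℕ.* m ℕ.+ n) ≡ D n
      D-periods zero    n = refl
      D-periods (suc q) n = trans (cong D (ℕ.+-assoc m (q ℕ.* m) n))
        (trans (D-period (q ℕ.* m ℕ.+ n)) (D-periods q n))

      ∑<-mono : ∀ {k l} → k ℕ.≤ l → ∑< k f ≤ ∑< l f
      ∑<-mono {k} {l} k≤l = begin
        ∑< k f                                  ≡⟨ +-identityʳ _ ⟨
        ∑< k f + 0ℚ                             ≤⟨ +-monoʳ-≤ (∑< k f) (0≤sum {l ℕ.∸ k} (λ i → 0≤f (k ℕ.+ toℕ i))) ⟩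
        ∑< k f + ∑< (l ℕ.∸ k) (f ∘ (k ℕ.+_))    ≡⟨ ∑<-+ k (l ℕ.∸ k) f ⟨
        ∑< (k ℕ.+ (l ℕ.∸ k)) f                  ≡⟨ cong (λ n → ∑< n f) (ℕ.m+[n∸m]≡n k≤l) ⟩
        ∑< l f                                  ∎
        where open ≤-Reasoning

    -- A full period adds `fromℕ m * p` to both terms of `D`, so `n` may be replaced by its
    -- remainder r modulo `m`. Then `∑< r f` and `fromℕ r * p` both lie between 0 and `fromℕ m * p`.
    ∣∑<-np∣≤mp : ∀ n → ∣ ∑< n f - fromℕ n * p ∣ ≤ fromℕ m * p
    ∣∑<-np∣≤mp n = begin
      ∣ D n ∣                              ≡⟨ cong (∣_∣ ∘ D) (trans (ℕ.m≡m%n+[m/n]*n n m) (ℕ.+-comm r _)) ⟩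
      ∣ D ((n ℕ./ m) ℕ.* m ℕ.+ r) ∣        ≡⟨ cong ∣_∣ (D-periods (n ℕ./ m) r) ⟩
      ∣ D r ∣                              ≤⟨ ∣p-q∣≤r (0≤sum {r} (0≤f ∘ toℕ))
                                              (≤-trans (∑<-mono r≤m) (≤-reflexive total))
                                              (0≤p*q (0≤fromℕ r) 0≤p)
                                              (*-monoʳ 0≤p (fromℕ-mono-≤ r≤m)) ⟩
      fromℕ m * p                          ∎
      where
      open ≤-Reasoning
      r = n ℕ.% m
      r≤m = ℕ.m%n≤n n m

-- Row vectors and stochastic matrices

infixl 6 _⊖_

_⊖_ : RowVec N → RowVec N → RowVec N
(x ⊖ y) v = x v - y v

‖_‖₁ : RowVec N → ℚ
‖ x ‖₁ = sumℚ (λ v → ∣ x v ∣)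

0≤‖_‖₁ : (x : RowVec N) → 0ℚ ≤ ‖ x ‖₁
0≤‖ x ‖₁ = 0≤sum (λ v → 0≤∣p∣ (x v))

‖‖₁-cong : {x y : RowVec N} → x ≗ y → ‖ x ‖₁ ≡ ‖ y ‖₁
‖‖₁-cong x≗y = sum-cong-≗ (cong ∣_∣ ∘ x≗y)

0≤⇒‖‖₁≡sum : {x : RowVec N} → (∀ v → 0ℚ ≤ x v) → ‖ x ‖₁ ≡ sumℚ x
0≤⇒‖‖₁≡sum 0≤x = sum-cong-≗ (0≤p⇒∣p∣≡p ∘ 0≤x)

‖x⊖y‖₁≤‖x‖₁+‖y‖₁ : (x y : RowVec N) → ‖ x ⊖ y ‖₁ ≤ ‖ x ‖₁ + ‖ y ‖₁
‖x⊖y‖₁≤‖x‖₁+‖y‖₁ x y = ≤-trans (sum-mono (λ v → ∣p-q∣≤∣p∣+∣q∣ (x v) (y v)))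
  (≤-reflexive (∑-distrib-+ (∣_∣ ∘ x) (∣_∣ ∘ y)))

-- For row vectors the ℓ¹ operator norm is the largest ℓ¹-norm of a row. It is used with c = 1 for
-- powers of `P` and with c = ½ for the deviation of a mixed power from its limit.
∙ᵛ-bounded : (x : RowVec N) (A : Matrix N) {c : ℚ} →
  (∀ v → ‖ A v ‖₁ ≤ c) → ‖ x ∙ᵛ A ‖₁ ≤ c * ‖ x ‖₁
∙ᵛ-bounded x A {c} A≤c = begin
  ‖ x ∙ᵛ A ‖₁                                     ≤⟨ sum-mono (λ u → ∣sum∣≤sum∣∣ (λ v → x v * A v u)) ⟩
  sumℚ (λ u → sumℚ (λ v → ∣ x v * A v u ∣))       ≡⟨ ∑-comm (λ u v → ∣ x v * A v u ∣) ⟩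
  sumℚ (λ v → sumℚ (λ u → ∣ x v * A v u ∣))       ≡⟨ sum-cong-≗ (λ v → trans
                                                      (sum-cong-≗ (λ u → ∣p*q∣≡∣p∣*∣q∣ (x v) (A v u)))
                                                      (sym (*-distribˡ-sum ∣ x v ∣ (∣_∣ ∘ A v)))) ⟩
  sumℚ (λ v → ∣ x v ∣ * ‖ A v ‖₁)                 ≤⟨ sum-mono (λ v → *-monoˡ (0≤∣p∣ (x v)) (A≤c v)) ⟩
  sumℚ (λ v → ∣ x v ∣ * c)                        ≡⟨ *-distribʳ-sum c (∣_∣ ∘ x) ⟨
  ‖ x ‖₁ * c                                      ≡⟨ *-comm ‖ x ‖₁ c ⟩
  c * ‖ x ‖₁                                      ∎
  where open ≤-Reasoning

∙ᵛ-congˡ : {x y : RowVec N} (A : Matrix N) → x ≗ y → x ∙ᵛ A ≗ y ∙ᵛ A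
∙ᵛ-congˡ A x≗y u = sum-cong-≗ (λ v → cong (_* A v u) (x≗y v))

∙ᵛ-⊖ : (x y : RowVec N) (A : Matrix N) → (x ⊖ y) ∙ᵛ A ≗ (x ∙ᵛ A) ⊖ (y ∙ᵛ A)
∙ᵛ-⊖ x y A u = trans
  (sum-cong-≗ (λ v → solve 3 (λ x y a → (x :- y) :* a := x :* a :- y :* a) refl (x v) (y v) (A v u)))
  (sum-sub (λ v → x v * A v u) (λ v → y v * A v u))

∙ᵛ-assoc : (x : RowVec N) (A B : Matrix N) → (x ∙ᵛ A) ∙ᵛ B ≗ x ∙ᵛ (A ∙ᵐ B)
∙ᵛ-assoc x A B w = begin
  sumℚ (λ v → sumℚ (λ u → x u * A u v) * B v w)    ≡⟨ sum-cong-≗ (λ v → *-distribʳ-sum (B v w) (λ u → x u * A u v)) ⟩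
  sumℚ (λ v → sumℚ (λ u → x u * A u v * B v w))    ≡⟨ ∑-comm (λ v u → x u * A u v * B v w) ⟩
  sumℚ (λ u → sumℚ (λ v → x u * A u v * B v w))    ≡⟨ sum-cong-≗ (λ u → trans
                                                       (sum-cong-≗ (λ v → *-assoc (x u) (A u v) (B v w)))
                                                       (sym (*-distribˡ-sum (x u) (λ v → A u v * B v w)))) ⟩
  sumℚ (λ u → x u * sumℚ (λ v → A u v * B v w))    ∎
  where open ≡-Reasoning

idMatrix-diag : (v : Fin N) → idMatrix v v ≡ 1ℚ
idMatrix-diag v with v Fin.≟ v
... | yes _   = refl
... | no  v≢v = contradiction refl v≢v

idMatrix-off : {u v : Fin N} → u ≢ v → idMatrix u v ≡ 0ℚ
idMatrix-off {u = u} {v} u≢v with u Fin.≟ v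
... | yes u≡v = contradiction u≡v u≢v
... | no  _   = refl

∙ᵛ-identityʳ : (x : RowVec N) → x ∙ᵛ idMatrix ≗ x
∙ᵛ-identityʳ x u = trans
  (sum-single u (λ v v≢u → trans (cong (x v *_) (idMatrix-off v≢u)) (*-zeroʳ (x v))))
  (trans (cong (x u *_) (idMatrix-diag u)) (*-identityʳ (x u)))

idMatrix-∙ᵛ : (u : Fin N) (A : Matrix N) → idMatrix u ∙ᵛ A ≗ A u
idMatrix-∙ᵛ u A w = trans
  (sum-single u (λ v v≢u → trans (cong (_* A v w) (idMatrix-off (v≢u ∘ sym))) (*-zeroˡ (A v w))))
  (trans (cong (_* A u w) (idMatrix-diag u)) (*-identityˡ (A u w)))

^ᵐ-+ : (P : Matrix N) (s t : ℕ) (u : Fin N) → (P ^ᵐ s) u ∙ᵛ P ^ᵐ t ≗ (P ^ᵐ (s ℕ.+ t)) u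
^ᵐ-+ P zero    t u w = idMatrix-∙ᵛ u (P ^ᵐ t) w
^ᵐ-+ P (suc s) t u w = begin
  ((P u ∙ᵛ P ^ᵐ s) ∙ᵛ P ^ᵐ t) w                 ≡⟨ ∙ᵛ-assoc (P u) (P ^ᵐ s) (P ^ᵐ t) w ⟩
  (P u ∙ᵛ (P ^ᵐ s ∙ᵐ P ^ᵐ t)) w                 ≡⟨ sum-cong-≗ (λ v → cong (P u v *_) (^ᵐ-+ P s t v w)) ⟩
  (P u ∙ᵛ P ^ᵐ (s ℕ.+ t)) w                     ∎
  where open ≡-Reasoning

-- `_^ᵐ_` puts the new factor on the left, but reversing a path moves its first step to the end.
^ᵐ-sucʳ : (P : Matrix N) (t : ℕ) (u : Fin N) → (P ^ᵐ t) u ∙ᵛ P ≗ (P ^ᵐ suc t) u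
^ᵐ-sucʳ P t u w = begin
  ((P ^ᵐ t) u ∙ᵛ P) w                ≡⟨ sum-cong-≗ (λ v → cong ((P ^ᵐ t) u v *_) (sym (∙ᵛ-identityʳ (P v) w))) ⟩
  ((P ^ᵐ t) u ∙ᵛ P ^ᵐ 1) w           ≡⟨ ^ᵐ-+ P t 1 u w ⟩
  (P ^ᵐ (t ℕ.+ 1)) u w               ≡⟨ cong (λ s → (P ^ᵐ s) u w) (ℕ.+-comm t 1) ⟩
  (P ^ᵐ suc t) u w                   ∎
  where open ≡-Reasoning

sum-∙ᵛ : (x : RowVec N) (A : Matrix N) → (∀ v → sumℚ (A v) ≡ 1ℚ) → sumℚ (x ∙ᵛ A) ≡ sumℚ x
sum-∙ᵛ x A rowSum = trans (∑-comm (λ u v → x v * A v u)) (sum-cong-≗ (λ v → trans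
  (sym (*-distribˡ-sum (x v) (A v))) (trans (cong (x v *_) (rowSum v)) (*-identityʳ (x v)))))

^ᵐ-stochastic : {P : Matrix N} → IsStochastic P → ∀ t → IsStochastic (P ^ᵐ t)
^ᵐ-stochastic {P = P} stoch = go
  where
  open IsStochastic
  go : ∀ t → IsStochastic (P ^ᵐ t)
  go zero .entry≥0 u v with u Fin.≟ v
  ... | yes _ = nonNegative⁻¹ 1ℚ
  ... | no  _ = ≤-refl
  go zero .rowSum u = trans (sum-single u (λ v v≢u → idMatrix-off (v≢u ∘ sym))) (idMatrix-diag u)
  go (suc t) .entry≥0 u w = 0≤sum (λ v → 0≤p*q (stoch .entry≥0 u v) (go t .entry≥0 v w))
  go (suc t) .rowSum u = trans (sum-∙ᵛ (P u) (P ^ᵐ t) (go t .rowSum)) (stoch .rowSum u)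

^ᵐ-stationary : {P : Matrix N} {π : RowVec N} → π ∙ᵛ P ≗ π → ∀ t → π ∙ᵛ P ^ᵐ t ≗ π
^ᵐ-stationary {π = π} π∙P≗π zero    = ∙ᵛ-identityʳ π
^ᵐ-stationary {P = P} {π} π∙P≗π (suc t) v = begin
  (π ∙ᵛ P ^ᵐ suc t) v      ≡⟨ ∙ᵛ-assoc π P (P ^ᵐ t) v ⟨
  ((π ∙ᵛ P) ∙ᵛ P ^ᵐ t) v   ≡⟨ ∙ᵛ-congˡ (P ^ᵐ t) π∙P≗π v ⟩
  (π ∙ᵛ P ^ᵐ t) v          ≡⟨ ^ᵐ-stationary π∙P≗π t v ⟩
  π v                      ∎
  where open ≡-Reasoning

^ᵐ-reversible : (P : Matrix N) (π : RowVec N) → Reversible P π → ∀ t → Reversible (P ^ᵐ t) π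
^ᵐ-reversible P π rev zero u w with u Fin.≟ w | w Fin.≟ u
... | yes refl | yes _   = refl
... | yes u≡w  | no  w≢u = contradiction (sym u≡w) w≢u
... | no  u≢w  | yes w≡u = contradiction (sym w≡u) u≢w
... | no  _    | no  _   = trans (*-zeroʳ (π u)) (sym (*-zeroʳ (π w)))
^ᵐ-reversible P π rev (suc t) u w = begin
  π u * sumℚ (λ v → P u v * Q v w)       ≡⟨ *-distribˡ-sum (π u) (λ v → P u v * Q v w) ⟩
  sumℚ (λ v → π u * (P u v * Q v w))     ≡⟨ sum-cong-≗ exchange ⟩
  sumℚ (λ v → π w * (Q w v * P v u))     ≡⟨ *-distribˡ-sum (π w) (λ v → Q w v * P v u) ⟨
  π w * (Q w ∙ᵛ P) u                     ≡⟨ cong (π w *_) (^ᵐ-sucʳ P t w u) ⟩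
  π w * (P ^ᵐ suc t) w u                 ∎
  where
  open ≡-Reasoning
  Q = P ^ᵐ t
  -- Detailed balance is applied to the first step and then, by induction, to the remaining t steps;
  -- this carries the weight from `u` through `v` to `w`.
  exchange : ∀ v → π u * (P u v * Q v w) ≡ π w * (Q w v * P v u)
  exchange v = begin
    π u * (P u v * Q v w)   ≡⟨ *-assoc (π u) _ _ ⟨
    π u * P u v * Q v w     ≡⟨ cong (_* Q v w) (rev u v) ⟩
    π v * P v u * Q v w     ≡⟨ solve 3 (λ a b c → a :* b :* c := a :* c :* b) refl (π v) (P v u) (Q v w) ⟩
    π v * Q v w * P v u     ≡⟨ cong (_* P v u) (^ᵐ-reversible P π rev t v w) ⟩
    π w * Q w v * P v u     ≡⟨ *-assoc (π w) _ _ ⟩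
    π w * (Q w v * P v u)   ∎

-- Mixing

2ℚ : ℚ
2ℚ = fromℕ 2

-- The tail sum F of e from k onwards satisfies F ≤ k/2 + F/2.
∑<-geometric : (e : ℕ → ℚ) (k : ℕ) → (∀ s → 0ℚ ≤ e s) → (∀ s → e s ≤ 2ℚ) →
  (∀ s → e (k ℕ.+ s) ≤ ½) → (∀ s → e (k ℕ.+ s) ≤ ½ * e s) →
  ∀ T → ∑< T e ≤ fromℕ 3 * fromℕ k
∑<-geometric e k 0≤e e≤2 e≤½ halves T = begin
  -- The 3 is 2 + 1: each of the first `k` terms is at most 2, and the whole tail is at most `k`.
  ∑< T e                         ≤⟨ extend e 0≤e ⟩
  ∑< k e + F                     ≤⟨ +-mono-≤ (block e e≤2) F≤k ⟩
  fromℕ k * 2ℚ + fromℕ k         ≡⟨ solve 1 (λ k → k :* con 2ℚ :+ k := con (fromℕ 3) :* k) refl (fromℕ k) ⟩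
  fromℕ 3 * fromℕ k              ∎
  where
  open ≤-Reasoning
  f : ℕ → ℚ
  f = e ∘ (k ℕ.+_)
  F = ∑< T f
  block : ∀ g {c} → (∀ s → g s ≤ c) → ∑< k g ≤ fromℕ k * c
  block g {c} g≤c = ≤-trans (sum-mono {k} (g≤c ∘ toℕ)) (≤-reflexive (∑<-const k c))
  -- Padding the sum with `k` further nonnegative terms keeps the shifted part at length `T`, so
  -- that `F` itself reappears in the bound on `F`.
  extend : ∀ g → (∀ s → 0ℚ ≤ g s) → ∑< T g ≤ ∑< k g + ∑< T (g ∘ (k ℕ.+_))
  extend g 0≤g = begin
    ∑< T g                               ≡⟨ +-identityʳ _ ⟨
    ∑< T g + 0ℚ                          ≤⟨ +-monoʳ-≤ (∑< T g) (0≤sum {k} (λ s → 0≤g (T ℕ.+ toℕ s))) ⟩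
    ∑< T g + ∑< k (g ∘ (T ℕ.+_))         ≡⟨ ∑<-+ T k g ⟨
    ∑< (T ℕ.+ k) g                       ≡⟨ cong (λ n → ∑< n g) (ℕ.+-comm T k) ⟩
    ∑< (k ℕ.+ T) g                       ≡⟨ ∑<-+ k T g ⟩
    ∑< k g + ∑< T (g ∘ (k ℕ.+_))         ∎
  F≤½k+½F : F ≤ fromℕ k * ½ + ½ * F
  F≤½k+½F = ≤-trans (extend f (0≤e ∘ (k ℕ.+_))) (+-mono-≤ (block f e≤½)
    (≤-trans (sum-mono {T} (λ s → halves (k ℕ.+ toℕ s)))
      (≤-reflexive (sym (*-distribˡ-sum {T} ½ (f ∘ toℕ))))))
  F≤k : F ≤ fromℕ k
  F≤k = begin
    F                                       ≡⟨ solve 1 (λ F → F := con 2ℚ :* (F :- con ½ :* F)) refl F ⟩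
    2ℚ * (F - ½ * F)                        ≤⟨ *-monoˡ {2ℚ} (0≤fromℕ 2) (+-monoˡ-≤ (- (½ * F)) F≤½k+½F) ⟩
    2ℚ * (fromℕ k * ½ + ½ * F - ½ * F)      ≡⟨ solve 2 (λ k F → con 2ℚ :* (k :* con ½ :+ con ½ :* F :- con ½ :* F) := k) refl (fromℕ k) F ⟩
    fromℕ k                                 ∎

module Mixing {P : Matrix N} {π : RowVec N} (stoch : IsStochastic P) (stat : IsStationary P π) where

  private
    module π = IsStationary stat
    module P^ t = IsStochastic (^ᵐ-stochastic stoch t)

  -- This is twice `dTV`, so the mixing threshold 1/4 becomes ½.
  dist : Fin N → ℕ → ℚ
  dist v t = ‖ (P ^ᵐ t) v ⊖ π ‖₁

  row-norm : ∀ t v → ‖ (P ^ᵐ t) v ‖₁ ≡ 1ℚ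
  row-norm t v = trans (0≤⇒‖‖₁≡sum (P^.entry≥0 t v)) (P^.rowSum t v)

  dist≤2 : ∀ v t → dist v t ≤ 2ℚ
  dist≤2 v t = ≤-trans (‖x⊖y‖₁≤‖x‖₁+‖y‖₁ ((P ^ᵐ t) v) π)
    (≤-reflexive (cong₂ _+_ (row-norm t v) (trans (0≤⇒‖‖₁≡sum π.entry≥0) π.total)))

  deviation-+ : ∀ s t v → ((P ^ᵐ s) v ⊖ π) ∙ᵛ P ^ᵐ t ≗ (P ^ᵐ (s ℕ.+ t)) v ⊖ π
  deviation-+ s t v u = trans (∙ᵛ-⊖ ((P ^ᵐ s) v) π (P ^ᵐ t) u)
    (cong₂ _-_ (^ᵐ-+ P s t v u) (^ᵐ-stationary π.balanced t u))

  -- A power of `P` fixes `π` and does not increase the ℓ¹-norm.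
  dist-antitone : ∀ v {s t} → s ℕ.≤ t → dist v t ≤ dist v s
  dist-antitone v {s} {t} s≤t = begin
    dist v t                                      ≡⟨ cong (dist v) (ℕ.m+[n∸m]≡n s≤t) ⟨
    dist v (s ℕ.+ k)                              ≡⟨ ‖‖₁-cong (deviation-+ s k v) ⟨
    ‖ ((P ^ᵐ s) v ⊖ π) ∙ᵛ P ^ᵐ k ‖₁               ≤⟨ ∙ᵛ-bounded ((P ^ᵐ s) v ⊖ π) (P ^ᵐ k) (≤-reflexive ∘ row-norm k) ⟩
    1ℚ * dist v s                                 ≡⟨ *-identityˡ _ ⟩
    dist v s                                      ∎
    where
    open ≤-Reasoning
    k = t ℕ.∸ s

  module _ (k : ℕ) (mixed : ∀ v → dist v k ≤ ½) where

    private
      B : Matrix N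
      B v = (P ^ᵐ k) v ⊖ π

      -- The matrix with all rows `π` sends `x` to its total mass times `π`. Hence `B` subtracts `π`
      -- from the image of a probability vector, as in `dist-shift≤½`, and acts as `P ^ᵐ k` on
      -- vectors of mass 0, as in `dist-halves`.
      ∙ᵛ-B : ∀ x u → (x ∙ᵛ B) u ≡ (x ∙ᵛ P ^ᵐ k) u - sumℚ x * π u
      ∙ᵛ-B x u = begin
        sumℚ (λ v → x v * (A v u - π u))               ≡⟨ sum-cong-≗ (λ v → solve 3 (λ x a p → x :* (a :- p) := x :* a :- x :* p) refl (x v) (A v u) (π u)) ⟩
        sumℚ (λ v → x v * A v u - x v * π u)           ≡⟨ sum-sub (λ v → x v * A v u) (λ v → x v * π u) ⟩
        (x ∙ᵛ A) u - sumℚ (λ v → x v * π u)            ≡⟨ cong (λ y → (x ∙ᵛ A) u - y) (*-distribʳ-sum (π u) x) ⟨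
        (x ∙ᵛ A) u - sumℚ x * π u                      ∎
        where
        open ≡-Reasoning
        A = P ^ᵐ k

    dist-shift≤½ : ∀ w s → dist w (k ℕ.+ s) ≤ ½
    dist-shift≤½ w s = begin
      dist w (k ℕ.+ s)            ≡⟨ ‖‖₁-cong expand ⟨
      ‖ (P ^ᵐ s) w ∙ᵛ B ‖₁        ≤⟨ ∙ᵛ-bounded ((P ^ᵐ s) w) B mixed ⟩
      ½ * ‖ (P ^ᵐ s) w ‖₁         ≡⟨ cong (½ *_) (row-norm s w) ⟩
      ½                           ∎
      where
      open ≤-Reasoning
      expand : (P ^ᵐ s) w ∙ᵛ B ≗ (P ^ᵐ (k ℕ.+ s)) w ⊖ π
      expand u = trans (∙ᵛ-B ((P ^ᵐ s) w) u) (cong₂ _-_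
        (trans (^ᵐ-+ P s k w u) (cong (λ t → (P ^ᵐ t) w u) (ℕ.+-comm s k)))
        (trans (cong (_* π u) (P^.rowSum s w)) (*-identityˡ (π u))))

    dist-halves : ∀ w s → dist w (k ℕ.+ s) ≤ ½ * dist w s
    dist-halves w s = begin
      dist w (k ℕ.+ s)            ≡⟨ ‖‖₁-cong expand ⟨
      ‖ x ∙ᵛ B ‖₁                 ≤⟨ ∙ᵛ-bounded x B mixed ⟩
      ½ * dist w s                ∎
      where
      open ≤-Reasoning
      x = (P ^ᵐ s) w ⊖ π
      sum-x : sumℚ x ≡ 0ℚ
      sum-x = trans (sum-sub ((P ^ᵐ s) w) π) (cong₂ _-_ (P^.rowSum s w) π.total)
      expand : x ∙ᵛ B ≗ (P ^ᵐ (k ℕ.+ s)) w ⊖ π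
      expand u = trans (∙ᵛ-B x u) (trans
        (cong₂ (λ a c → a - c * π u)
          (trans (deviation-+ s k w u) (cong (λ t → (P ^ᵐ t) w u - π u) (ℕ.+-comm s k))) sum-x)
        (solve 2 (λ a p → a :- con 0ℚ :* p := a) refl ((P ^ᵐ (k ℕ.+ s)) w u - π u) (π u)))

    ∑dist≤3k : ∀ w T → ∑< T (dist w) ≤ fromℕ 3 * fromℕ k
    ∑dist≤3k w = ∑<-geometric (dist w) k (λ s → 0≤‖ (P ^ᵐ s) w ⊖ π ‖₁)
      (dist≤2 w) (dist-shift≤½ w) (dist-halves w)

  -- Each start `v` reaches the threshold at its own time `τ v`; monotonicity carries this to the
  -- common maximum. Cancelling ½ works because 1/4 is ½ * ½.
  mixingRate-mixed : ∀ {t*} → IsMixingRate P π t* → ∀ v → dist v t* ≤ ½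
  mixingRate-mixed (τ , least , refl) v = ≤-trans (dist-antitone v (≤maxℕ τ v))
    (*-cancelˡ-≤-pos ½ (proj₁ (least v)))

-- Discrepancy of the rotor router

module Discrepancy {P : Matrix N} (stoch : IsStochastic P) (R : RotorRouter P) where

  open RotorRouter R hiding (χ; Δ̄)
  private
    module P = IsStochastic stoch

  hit : (v u : Fin N) → ℕ → ℚ
  hit v u i = 𝟙 (σ v i Fin.≟ u)

  private
    module _ (v : Fin N) where
      instance
        δ̄≢0 : ℕ.NonZero (δ̄ v)
        δ̄≢0 = δ̄-nonZero v

      hit-periodic : ∀ u i → hit v u (δ̄ v ℕ.+ i) ≡ hit v u i
      hit-periodic u i = cong (λ j → 𝟙 (rotor v j Fin.≟ u)) (Fin.toℕ-injective (begin
        toℕ ((δ̄ v ℕ.+ i) ℕ.mod δ̄ v)    ≡⟨ Fin.toℕ-fromℕ< _ ⟩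
        (δ̄ v ℕ.+ i) ℕ.% δ̄ v            ≡⟨ cong (ℕ._% δ̄ v) (ℕ.+-comm (δ̄ v) i) ⟩
        (i ℕ.+ δ̄ v) ℕ.% δ̄ v            ≡⟨ ℕ.[m+n]%n≡m%n i (δ̄ v) ⟩
        i ℕ.% δ̄ v                      ≡⟨ Fin.toℕ-fromℕ< _ ⟨
        toℕ (i ℕ.mod δ̄ v)              ∎))
        where open ≡-Reasoning

      hit-rotor : ∀ u (j : Fin (δ̄ v)) → hit v u (toℕ j) ≡ 𝟙 (rotor v j Fin.≟ u)
      hit-rotor u j = cong (λ j → 𝟙 (rotor v j Fin.≟ u)) (Fin.toℕ-injective
        (trans (Fin.toℕ-fromℕ< _) (ℕ.m<n⇒m%n≡m (Fin.toℕ<n j))))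

      -- `frequency` speaks only of `u` with `P v u > 0ℚ`. Elsewhere `P v u` is 0, and `rotor∈𝒩`
      -- prevents the rotor from ever pointing at `u`.
      hit-total : ∀ u → ∑< (δ̄ v) (hit v u) ≡ fromℕ (δ̄ v) * P v u
      hit-total u with 0ℚ <? P v u
      ... | yes 0<Pvu = trans (sum-cong-≗ {δ̄ v} (hit-rotor u)) (trans
              (sym (count-tabulate (λ j → rotor v j Fin.≟ u) id)) (frequency v u 0<Pvu))
      ... | no  0≮Pvu = trans (sum-zero {δ̄ v} (λ j → trans (hit-rotor u j) (off j)))
              (sym (trans (cong (fromℕ (δ̄ v) *_) Pvu≡0) (*-zeroʳ (fromℕ (δ̄ v)))))
        where
        Pvu≡0 : P v u ≡ 0ℚ
        Pvu≡0 = ≤-antisym (≮⇒≥ 0≮Pvu) (P.entry≥0 v u)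
        off : ∀ j → 𝟙 (rotor v j Fin.≟ u) ≡ 0ℚ
        off j with rotor v j Fin.≟ u
        ... | yes refl = contradiction (rotor∈𝒩 v j) 0≮Pvu
        ... | no  _    = refl

      -- The sequence read from `z` on is still periodic with the same total over a period, so the
      -- bound does not depend on how many tokens have already left `v`.
      window-discrepancy : ∀ u z n →
        ∣ ∑< n (hit v u ∘ (z ℕ.+_)) - fromℕ n * P v u ∣ ≤ fromℕ (δ̄ v) * P v u
      window-discrepancy u z = ∣∑<-np∣≤mp (hit v u ∘ (z ℕ.+_)) (P v u)
        (λ i → 0≤𝟙 (σ v (z ℕ.+ i) Fin.≟ u)) (P.entry≥0 v u) periodic
        (trans (shift-invariant (hit v u) (hit-periodic u) z) (hit-total u))
        where
        open Periodic (δ̄ v)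
        periodic : ∀ i → hit v u (z ℕ.+ (δ̄ v ℕ.+ i)) ≡ hit v u (z ℕ.+ i)
        periodic i = trans
          (cong (hit v u) (trans (sym (ℕ.+-assoc z (δ̄ v) i))
            (trans (cong (ℕ._+ i) (ℕ.+-comm z (δ̄ v))) (ℕ.+-assoc (δ̄ v) z i))))
          (hit-periodic u (z ℕ.+ i))

  fromℕ-I : ∀ v u z n → fromℕ (I v u z (z ℕ.+ n)) ≡ ∑< n (hit v u ∘ (z ℕ.+_))
  fromℕ-I v u z n = trans
    (cong (λ k → fromℕ (length (filter (λ j → σ v j Fin.≟ u) (applyUpTo (z ℕ.+_) k)))) (ℕ.m+n∸m≡n z n))
    (count-applyUpTo (λ j → σ v j Fin.≟ u) (z ℕ.+_) n)

  -- Each rotor position in the window points at exactly one target, so exchanging the sums leaves n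
  -- ones.
  sum-I : ∀ v z n → sumℚ (λ u → fromℕ (I v u z (z ℕ.+ n))) ≡ fromℕ n
  sum-I v z n = begin
    sumℚ (λ u → fromℕ (I v u z (z ℕ.+ n)))             ≡⟨ sum-cong-≗ (λ u → fromℕ-I v u z n) ⟩
    sumℚ (λ u → ∑< n (hit v u ∘ (z ℕ.+_)))             ≡⟨ ∑-comm {N} {n} (λ u i → hit v u (z ℕ.+ toℕ i)) ⟩
    ∑< n (λ i → sumℚ (λ u → hit v u (z ℕ.+ i)))        ≡⟨ sum-cong-≗ {n} (λ i → sum-𝟙≡1 (σ v (z ℕ.+ toℕ i))) ⟩
    ∑< n (λ _ → 1ℚ)                                    ≡⟨ ∑<-const n 1ℚ ⟩
    fromℕ n * 1ℚ                                       ≡⟨ *-identityʳ _ ⟩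
    fromℕ n                                            ∎
    where open ≡-Reasoning

  module Flow (χ₀ : Fin N → ℕ) (t : ℕ) where

    private
      Zₜ = Z χ₀ t
      χₜ = RotorRouter.χ R χ₀ t
      Xₜ = emitted χ₀ t

    excess : Fin N → Fin N → ℚ
    excess v u = fromℕ (Zₜ v u) - fromℕ (χₜ v) * P v u

    ∣excess∣≤ : ∀ v u → ∣ excess v u ∣ ≤ fromℕ (Δ̄ R) * P v u
    ∣excess∣≤ v u = begin
      ∣ excess v u ∣                                       ≡⟨ cong (λ z → ∣ z - fromℕ (χₜ v) * P v u ∣) (fromℕ-I v u (Xₜ v) (χₜ v)) ⟩
      ∣ ∑< (χₜ v) (hit v u ∘ (Xₜ v ℕ.+_)) - fromℕ (χₜ v) * P v u ∣  ≤⟨ window-discrepancy v u (Xₜ v) (χₜ v) ⟩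
      fromℕ (δ̄ v) * P v u                                  ≤⟨ *-monoʳ (P.entry≥0 v u) (fromℕ-mono-≤ (≤maxℕ δ̄ v)) ⟩
      fromℕ (Δ̄ R) * P v u                                  ∎
      where open ≤-Reasoning

    sum-excess : ∀ v → sumℚ (excess v) ≡ 0ℚ
    sum-excess v = begin
      sumℚ (excess v)                                            ≡⟨ sum-sub (fromℕ ∘ Zₜ v) (λ u → fromℕ (χₜ v) * P v u) ⟩
      sumℚ (fromℕ ∘ Zₜ v) - sumℚ (λ u → fromℕ (χₜ v) * P v u)    ≡⟨ cong₂ _-_ (sum-I v (Xₜ v) (χₜ v)) (trans
                                                                     (sym (*-distribˡ-sum (fromℕ (χₜ v)) (P v)))
                                                                     (cong (fromℕ (χₜ v) *_) (P.rowSum v))) ⟩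
      fromℕ (χₜ v) - fromℕ (χₜ v) * 1ℚ                           ≡⟨ solve 1 (λ x → x :- x :* con 1ℚ := con 0ℚ) refl (fromℕ (χₜ v)) ⟩
      0ℚ                                                         ∎
      where open ≡-Reasoning

    defect : RowVec N
    defect = (fromℕ ∘ RotorRouter.χ R χ₀ (suc t)) ⊖ ((fromℕ ∘ χₜ) ∙ᵛ P)

    defect≡∑excess : ∀ u → defect u ≡ sumℚ (λ v → excess v u)
    defect≡∑excess u = trans
      (cong (_- ((fromℕ ∘ χₜ) ∙ᵛ P) u) (fromℕ-sum (λ v → Zₜ v u)))
      (sym (sum-sub (λ v → fromℕ (Zₜ v u)) (λ v → fromℕ (χₜ v) * P v u)))

    -- One router step and one step of `P` both conserve mass. This is what later allows a constant
    -- to be subtracted from a column of a power of `P`.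
    sum-defect : sumℚ defect ≡ 0ℚ
    sum-defect = trans (sum-cong-≗ defect≡∑excess)
      (trans (∑-comm (λ u v → excess v u)) (sum-zero sum-excess))

    ∣defect∣≤ : ∀ u → ∣ defect u ∣ ≤ fromℕ (Δ̄ R) * sumℚ (λ v → P v u)
    ∣defect∣≤ u = begin
      ∣ defect u ∣                             ≡⟨ cong ∣_∣ (defect≡∑excess u) ⟩
      ∣ sumℚ (λ v → excess v u) ∣              ≤⟨ ∣sum∣≤sum∣∣ (λ v → excess v u) ⟩
      sumℚ (λ v → ∣ excess v u ∣)              ≤⟨ sum-mono (λ v → ∣excess∣≤ v u) ⟩
      sumℚ (λ v → fromℕ (Δ̄ R) * P v u)         ≡⟨ *-distribˡ-sum (fromℕ (Δ̄ R)) (λ v → P v u) ⟨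
      fromℕ (Δ̄ R) * sumℚ (λ v → P v u)         ∎
      where open ≤-Reasoning

-- Consequences of reversibility.

columnSum≤degree : {P : Matrix N} {π : RowVec N} → IsStochastic P → (∀ v → 0ℚ < π v) →
  Reversible P π → ∀ u → sumℚ (λ v → P v u) ≤ fromℕ (degree P u)
columnSum≤degree {P = P} {π} stoch 0<π rev u = begin
  sumℚ (λ v → P v u)                 ≤⟨ sum-mono bound ⟩
  sumℚ (λ v → 𝟙 (0ℚ <? P u v))       ≡⟨ count-tabulate (λ v → 0ℚ <? P u v) id ⟨
  fromℕ (degree P u)                 ∎
  where
  open ≤-Reasoning
  open IsStochastic stoch
  -- Since `π` is positive, detailed balance forces `P v u` to vanish wherever `P u v` does. So
  -- column `u` is supported on the neighbours of `u`, and there each entry is at most its row sum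
  -- 1.
  bound : ∀ v → P v u ≤ 𝟙 (0ℚ <? P u v)
  bound v with 0ℚ <? P u v
  ... | yes _     = ≤-trans (term≤sum (entry≥0 v) u) (≤-reflexive (rowSum v))
  ... | no  0≮Puv = *-cancelˡ-≤-pos (π v) ⦃ positive (0<π v) ⦄ (begin
    π v * P v u   ≡⟨ rev v u ⟩
    π u * P u v   ≤⟨ *-monoˡ (<⇒≤ (0<π u)) (≮⇒≥ 0≮Puv) ⟩
    π u * 0ℚ      ≡⟨ trans (*-zeroʳ (π u)) (sym (*-zeroʳ (π v))) ⟩
    π v * 0ℚ      ∎)

-- An entry of the column P^s_{·,w} is compared with one of the row P^s_{w,·},
-- since π_u (P^s_{u,w} − π_w) = π_w (P^s_{w,u} − π_u).
reversible-deviation : ∀ {n} {Q : Matrix (suc n)} {π : RowVec (suc n)} → (∀ v → 0ℚ ≤ π v) →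
  Reversible Q π → ∀ u w → minEntry π * ∣ Q u w - π w ∣ ≤ π w * ∣ Q w u - π u ∣
reversible-deviation {Q = Q} {π} 0≤π rev u w = begin
  minEntry π * ∣ Q u w - π w ∣     ≤⟨ *-monoʳ (0≤∣p∣ (Q u w - π w)) (minEntry≤ π u) ⟩
  π u * ∣ Q u w - π w ∣            ≡⟨ abs-* (0≤π u) (Q u w - π w) ⟨
  ∣ π u * (Q u w - π w) ∣          ≡⟨ cong ∣_∣ exchange ⟩
  ∣ π w * (Q w u - π u) ∣          ≡⟨ abs-* (0≤π w) (Q w u - π u) ⟩
  π w * ∣ Q w u - π u ∣            ∎
  where
  open ≤-Reasoning
  abs-* : ∀ {p} → 0ℚ ≤ p → ∀ q → ∣ p * q ∣ ≡ p * ∣ q ∣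
  abs-* {p} 0≤p q = trans (∣p*q∣≡∣p∣*∣q∣ p q) (cong (_* ∣ q ∣) (0≤p⇒∣p∣≡p 0≤p))
  exchange : π u * (Q u w - π w) ≡ π w * (Q w u - π u)
  exchange = trans (solve 3 (λ a q b → a :* (q :- b) := a :* q :- b :* a) refl (π u) (Q u w) (π w))
    (trans (cong (_- π w * π u) (rev u w))
      (solve 3 (λ a q b → b :* q :- b :* a := b :* (q :- a)) refl (π u) (Q w u) (π w)))

-- Propagation of the one-step errors and telescoping.

module Propagation {n} {P : Matrix (suc n)} {π : RowVec (suc n)}
  (stoch : IsStochastic P) (erg : IsErgodic P) (stat : IsStationary P π)
  (rev : Reversible P π) (R : RotorRouter P) (χ₀ : Fin (suc n) → ℕ) (w : Fin (suc n)) where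

  open Mixing stoch stat

  private
    πₘ = minEntry π
    Δ = fromℕ (maxDegree P)
    Δ̄ₘ = fromℕ (Δ̄ R)
    0<π = stationary-pos stoch (IsErgodic.irreducible erg) stat
    0≤π = IsStationary.entry≥0 stat
    X : ℕ → RowVec (suc n)
    X t = fromℕ ∘ χ R χ₀ t
    K = Δ̄ₘ * Δ * π w

  0<πₘ : 0ℚ < πₘ
  0<πₘ = argmin-all id {P = 0ℚ <_} (0<π zero) (tabulate⁺ 0<π)

  open Discrepancy stoch R using (module Flow)

  -- The effect at `w` of the error made in step `t`, after `s` further steps of the chain. Centring
  -- the column by `π w` allows passing to row `w` by reversibility, where the sum over `u` becomes
  -- `dist w s`.
  step : ∀ t s → πₘ * ∣ (Flow.defect χ₀ t ∙ᵛ P ^ᵐ s) w ∣ ≤ K * dist w s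
  step t s = begin
    πₘ * ∣ (defect ∙ᵛ Q) w ∣                                   ≡⟨ cong (λ x → πₘ * ∣ x ∣) centre ⟩
    πₘ * ∣ sumℚ (λ u → defect u * (Q u w - π w)) ∣             ≤⟨ *-monoˡ (<⇒≤ 0<πₘ) (∣sum∣≤sum∣∣ (λ u → defect u * (Q u w - π w))) ⟩
    πₘ * sumℚ (λ u → ∣ defect u * (Q u w - π w) ∣)             ≡⟨ *-distribˡ-sum πₘ (λ u → ∣ defect u * (Q u w - π w) ∣) ⟩
    sumℚ (λ u → πₘ * ∣ defect u * (Q u w - π w) ∣)             ≤⟨ sum-mono bound ⟩
    sumℚ (λ u → K * ∣ Q w u - π u ∣)                           ≡⟨ *-distribˡ-sum K (λ u → ∣ Q w u - π u ∣) ⟨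
    K * dist w s                                               ∎
    where
    open ≤-Reasoning
    open Flow χ₀ t
    Q = P ^ᵐ s
    centre : (defect ∙ᵛ Q) w ≡ sumℚ (λ u → defect u * (Q u w - π w))
    centre = sym (begin-equality
      sumℚ (λ u → defect u * (Q u w - π w))               ≡⟨ sum-cong-≗ (λ u → solve 3 (λ x a p → x :* (a :- p) := x :* a :- x :* p) refl (defect u) (Q u w) (π w)) ⟩
      sumℚ (λ u → defect u * Q u w - defect u * π w)      ≡⟨ sum-sub (λ u → defect u * Q u w) (λ u → defect u * π w) ⟩
      (defect ∙ᵛ Q) w - sumℚ (λ u → defect u * π w)       ≡⟨ cong (λ x → (defect ∙ᵛ Q) w - x) (trans (sym (*-distribʳ-sum (π w) defect)) (cong (_* π w) sum-defect)) ⟩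
      (defect ∙ᵛ Q) w - 0ℚ * π w                          ≡⟨ solve 2 (λ a p → a :- con 0ℚ :* p := a) refl ((defect ∙ᵛ Q) w) (π w) ⟩
      (defect ∙ᵛ Q) w                                     ∎)
    0≤Δ̄Δ : 0ℚ ≤ Δ̄ₘ * Δ
    0≤Δ̄Δ = 0≤p*q (0≤fromℕ (Δ̄ R)) (0≤fromℕ (maxDegree P))
    -- The error on each edge is at most `Δ̄ₘ` times the transition probability; summing over the
    -- edges into `u` gives a column sum, hence at most `Δ`.
    ∣defect∣≤Δ̄Δ : ∀ u → ∣ defect u ∣ ≤ Δ̄ₘ * Δ
    ∣defect∣≤Δ̄Δ u = ≤-trans (∣defect∣≤ u) (*-monoˡ (0≤fromℕ (Δ̄ R))
      (≤-trans (columnSum≤degree stoch 0<π rev u) (fromℕ-mono-≤ (≤maxℕ (degree P) u))))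
    bound : ∀ u → πₘ * ∣ defect u * (Q u w - π w) ∣ ≤ K * ∣ Q w u - π u ∣
    bound u = begin
      πₘ * ∣ defect u * (Q u w - π w) ∣        ≡⟨ cong (πₘ *_) (∣p*q∣≡∣p∣*∣q∣ (defect u) (Q u w - π w)) ⟩
      πₘ * (∣ defect u ∣ * ∣ Q u w - π w ∣)    ≡⟨ solve 3 (λ m d q → m :* (d :* q) := d :* (m :* q)) refl πₘ ∣ defect u ∣ ∣ Q u w - π w ∣ ⟩
      ∣ defect u ∣ * (πₘ * ∣ Q u w - π w ∣)    ≤⟨ *-monoʳ (0≤p*q (<⇒≤ 0<πₘ) (0≤∣p∣ (Q u w - π w))) (∣defect∣≤Δ̄Δ u) ⟩
      Δ̄ₘ * Δ * (πₘ * ∣ Q u w - π w ∣)          ≤⟨ *-monoˡ 0≤Δ̄Δ (reversible-deviation 0≤π (^ᵐ-reversible P π rev s) u w) ⟩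
      Δ̄ₘ * Δ * (π w * ∣ Q w u - π u ∣)         ≡⟨ *-assoc (Δ̄ₘ * Δ) (π w) ∣ Q w u - π u ∣ ⟨
      K * ∣ Q w u - π u ∣                      ∎

  -- Compares t router steps followed by s chain steps with t + s chain steps. The last router step
  -- is traded for a chain step at cost `K * dist w s`, and the induction goes on with s + 1; hence
  -- `s` must stay general.
  telescope : ∀ t s →
    πₘ * ∣ (X t ∙ᵛ P ^ᵐ s) w - (X 0 ∙ᵛ P ^ᵐ (t ℕ.+ s)) w ∣ ≤ K * ∑< t (dist w ∘ (ℕ._+ s))
  telescope zero s = ≤-reflexive (trans
    (cong (λ x → πₘ * ∣ x ∣) (+-inverseʳ ((X 0 ∙ᵛ P ^ᵐ s) w)))
    (trans (*-zeroʳ πₘ) (sym (*-zeroʳ K))))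
  telescope (suc t) s = begin
    πₘ * ∣ b - c ∣                              ≡⟨ cong (λ x → πₘ * ∣ x ∣) (solve 3 (λ a b c → b :- c := (b :- a) :+ (a :- c)) refl a b c) ⟩
    πₘ * ∣ (b - a) + (a - c) ∣                  ≤⟨ *-monoˡ (<⇒≤ 0<πₘ) (∣p+q∣≤∣p∣+∣q∣ (b - a) (a - c)) ⟩
    πₘ * (∣ b - a ∣ + ∣ a - c ∣)                ≡⟨ *-distribˡ-+ πₘ ∣ b - a ∣ ∣ a - c ∣ ⟩
    πₘ * ∣ b - a ∣ + πₘ * ∣ a - c ∣             ≤⟨ +-mono-≤ new old ⟩
    K * dist w s + K * ∑< t (dist w ∘ (ℕ._+ suc s))      ≡⟨ *-distribˡ-+ K (dist w s) _ ⟨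
    K * (dist w s + ∑< t (dist w ∘ (ℕ._+ suc s)))        ≡⟨ cong (λ x → K * (dist w s + x)) (sum-cong-≗ {t} (λ i → cong (dist w) (ℕ.+-suc (toℕ i) s))) ⟩
    K * ∑< (suc t) (dist w ∘ (ℕ._+ s))          ∎
    where
    open ≤-Reasoning
    -- The hybrid between `b` and `c`: one router step fewer than `b`, one chain step more.
    a = (X t ∙ᵛ P ^ᵐ suc s) w
    b = (X (suc t) ∙ᵛ P ^ᵐ s) w
    c = (X 0 ∙ᵛ P ^ᵐ (suc t ℕ.+ s)) w
    new : πₘ * ∣ b - a ∣ ≤ K * dist w s
    new = subst (λ x → πₘ * ∣ x ∣ ≤ K * dist w s)
      (trans (∙ᵛ-⊖ (X (suc t)) (X t ∙ᵛ P) (P ^ᵐ s) w)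
        (cong (λ x → b - x) (∙ᵛ-assoc (X t) P (P ^ᵐ s) w)))
      (step t s)
    -- The induction hypothesis has exponent `t ℕ.+ suc s`, whereas `c` has `suc t ℕ.+ s`.
    old : πₘ * ∣ a - c ∣ ≤ K * ∑< t (dist w ∘ (ℕ._+ suc s))
    old = subst (λ k → πₘ * ∣ a - (X 0 ∙ᵛ P ^ᵐ k) w ∣ ≤ K * ∑< t (dist w ∘ (ℕ._+ suc s)))
      (ℕ.+-suc t s) (telescope t (suc s))

  discrepancy : ∀ T →
    πₘ * ∣ fromℕ (χ R χ₀ T w) - μ P χ₀ T w ∣ ≤ K * ∑< T (dist w)
  discrepancy T = subst₂ _≤_
    (cong₂ (λ x k → πₘ * ∣ x - μ P χ₀ k w ∣) (∙ᵛ-identityʳ (X T) w) (ℕ.+-identityʳ T))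
    (cong (K *_) (sum-cong-≗ {T} (λ i → cong (dist w) (ℕ.+-identityʳ (toℕ i)))))
    (telescope T 0)

theorem5p9 : ∀ {n} (P : Matrix (suc n)) (π : RowVec (suc n))
    (stoch : IsStochastic P) (erg : IsErgodic P) (stat : IsStationary P π) →
    Reversible P π →
    (t* : ℕ) → IsMixingRate P π t* →
    (R : RotorRouter P) (χ₀ : Fin (suc n) → ℕ) (w : Fin (suc n)) (T : ℕ) →
    ∣ fromℕ (χ R χ₀ T w) - μ P χ₀ T w ∣
    ≤ _÷_ (fromℕ 3 * π w) (minEntry π) {{minEntry-nonZero stoch erg stat}}
    * fromℕ t* * fromℕ (maxDegree P) * fromℕ (Δ̄ R)
theorem5p9 P π stoch erg stat rev t* mix R χ₀ w T = begin
  -- The sum of the distances is at most 3 `t*` for every `T`, which makes the bound uniform in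
  -- time; only here is `minEntry π` divided out.
  ∣ fromℕ (χ R χ₀ T w) - μ P χ₀ T w ∣             ≤⟨ p≤1/m*q ⦃ minEntry-nonZero stoch erg stat ⦄ 0<πₘ (≤-trans (discrepancy T)
                                                     (*-monoˡ 0≤K (∑dist≤3k t* (mixingRate-mixed mix) w T))) ⟩
  1/πₘ * (Δ̄ₘ * Δ * π w * (fromℕ 3 * fromℕ t*))    ≡⟨ solve 6 (λ m d̄ d p c t → m :* (d̄ :* d :* p :* (c :* t)) := c :* p :* m :* t :* d :* d̄)
                                                     refl 1/πₘ Δ̄ₘ Δ (π w) (fromℕ 3) (fromℕ t*) ⟩
  fromℕ 3 * π w * 1/πₘ * fromℕ t* * Δ * Δ̄ₘ        ∎
  where
  open ≤-Reasoning
  open Propagation stoch erg stat rev R χ₀ w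
  open Mixing stoch stat
  1/πₘ = (1/ minEntry π) ⦃ minEntry-nonZero stoch erg stat ⦄
  Δ = fromℕ (maxDegree P)
  Δ̄ₘ = fromℕ (Δ̄ R)
  0≤K : 0ℚ ≤ Δ̄ₘ * Δ * π w
  0≤K = 0≤p*q (0≤p*q (0≤fromℕ (Δ̄ R)) (0≤fromℕ (maxDegree P))) (IsStationary.entry≥0 stat w)
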